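{- Let $1\le i<j\le N$. All but the $i$-th column of $\widetilde{\mathbf{M}}_{j,i}$ are upper-triangular; that is, for every $k\in\{1,\dots,N-1\}$ with $k\ne i$, the column $C_k^{\widetilde{\mathbf{M}}_{j,i}}$ is upper-triangular.
   Context: Let $G$ be a finite tree (connected acyclic simple graph) with nodes $n_0,n_1,\dots,n_N$, where $n_0$ is a terminal node (degree one) and the nodes are indexed so that along the path in $G$ from $n_0$ to any node $n_i$ the successively encountered node indices strictly increase. Node $n_i$ is forward-adjacent to $n_k$ if $n_i$ and $n_k$ are adjacent and $i<k$. The forward adjacency matrix $\mathbf{A}$ of $G$ is the $N\times N$ matrix, with rows and columns indexed by $1,\dots,N$, given by $\mathbf{A}(i,j)=1$ if $i=j$, $\mathbf{A}(i,j)=-1$ if $n_i$ is forward-adjacent to $n_j$, and $\mathbf{A}(i,j)=0$ otherwise. $\mathbf{M}_{j,i}$ is the $(N-1)\times(N-1)$ matrix obtained from $\mathbf{A}$ by deleting its $j$-th row and $i$-th column (rows and columns then renumbered $1,\dots,N-1$). $\widetilde{\mathbf{M}}_{j,i}$ is the matrix obtained from $\mathbf{M}_{j,i}$ by moving its $(j-1)$-th column to the $i$-th position by the successive interchanges of neighbouring columns: positions $j-1\leftrightarrow j-2$, then $j-2\leftrightarrow j-3$, ..., finally $i+1\leftrightarrow i$ (no interchange if $i=j-1$). $C^{\mathbf{Q}}_k$ denotes the $k$-th column of a matrix $\mathbf{Q}$; it is called upper-triangular if $\mathbf{Q}(x,k)=0$ for all $x>k$. -}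

module Defs where

open import Level using (0ℓ)
open import Data.Nat.Base as ℕ using (ℕ; zero; suc; _∸_)
open import Data.Integer.Base using (ℤ; 0ℤ; 1ℤ; -1ℤ)
open import Data.Fin.Base using (Fin; zero; suc; toℕ; pred; _<_)
open import Data.Fin.Properties using (_≟_; _<?_)
open import Data.Fin.Permutation.Components using (transpose)
open import Data.List.Base using (List; []; _∷_; length; filter; allFin)
open import Data.List.Relation.Unary.Linked using (Linked)
open import Data.List.Relation.Unary.Unique.Propositional using (Unique)
open import Data.Vec.Functional using (Vector; map; removeAt)
open import Data.Bool.Base using (if_then_else_)
open import Data.Product.Base using (_×_)
open import Relation.Binary.Core using (Rel)
open import Relation.Binary.Definitions
  using (Decidable; Symmetric; Irreflexive)
open import Relation.Binary.Construct.Closure.ReflexiveTransitive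
  using (Star; ε; _◅_)
open import Relation.Binary.PropositionalEquality.Core using (_≡_)
open import Relation.Nullary using (¬_; does)
open import Relation.Nullary.Decidable using (_×-dec_)

record SimpleGraph (n : ℕ) : Set₁ where
  field
    Adj    : Rel (Fin n) 0ℓ
    adj?   : Decidable Adj
    sym    : Symmetric Adj
    irrefl : Irreflexive _≡_ Adj

  Walk : Rel (Fin n) 0ℓ
  Walk = Star Adj

  vertices : ∀ {u v} → Walk u v → List (Fin n)
  vertices {u} ε       = u ∷ []
  vertices {u} (_ ◅ w) = u ∷ vertices w

  IsPath : ∀ {u v} → Walk u v → Set
  IsPath w = Unique (vertices w)

  degree : Fin n → ℕ
  degree u = length (filter (adj? u) (allFin n))

  Connected : Set
  Connected = ∀ u v → Walk u v

  -- A cycle is a path on at least three vertices together with an edge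
  -- joining its last vertex to its first.
  Acyclic : Set
  Acyclic = ∀ {u v} (w : Walk u v) → IsPath w →
            3 ℕ.≤ length (vertices w) → ¬ Adj v u

-- Node n_i of the tree is the element of Fin (suc N) with value i.
record IndexedTree (N : ℕ) : Set₁ where
  field
    graph : SimpleGraph (suc N)
  open SimpleGraph graph public
  field
    connected  : Connected
    acyclic    : Acyclic
    terminal   : degree zero ≡ 1
    increasing : ∀ {v} (w : Walk zero v) → IsPath w → Linked _<_ (vertices w)

  ForwardAdj : Rel (Fin (suc N)) 0ℓ
  ForwardAdj u v = Adj u v × u < v

  forwardAdj? : Decidable ForwardAdj
  forwardAdj? u v = adj? u v ×-dec (u <? v)

-- Rows and columns are indexed from 0, one less than the usual 1-based index.
Matrix : ℕ → ℕ → Set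
Matrix m n = Vector (Vector ℤ n) m

-- Row and column i : Fin N belong to the node suc i; the node zero has neither.
forwardAdjacencyMatrix : ∀ {N} → IndexedTree N → Matrix N N
forwardAdjacencyMatrix T i j =
  if does (i ≟ j) then 1ℤ
  else if does (forwardAdj? (suc i) (suc j)) then -1ℤ
  else 0ℤ
  where open IndexedTree T

deleteRowColumn : ∀ {m n} → Fin (suc m) → Fin (suc n) →
                  Matrix (suc m) (suc n) → Matrix m n
deleteRowColumn r c Q = map (λ row → removeAt row c) (removeAt Q r)

swapColumns : ∀ {m n} → Fin n → Fin n → Matrix m n → Matrix m n
swapColumns a b Q x k = Q x (transpose a b k)

-- The interchanges p ↔ p-1, p-1 ↔ p-2, …, performed in this order, s of them.
-- Since pred zero = zero, this is as intended only for s ≤ toℕ p.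
moveColumnLeft : ∀ {m n} → Fin n → (s : ℕ) → Matrix m n → Matrix m n
moveColumnLeft p zero    Q = Q
moveColumnLeft p (suc s) Q = moveColumnLeft (pred p) s (swapColumns p (pred p) Q)

M : ∀ {n} → IndexedTree (suc n) → (j i : Fin (suc n)) → Matrix n n
M T j i = deleteRowColumn j i (forwardAdjacencyMatrix T)

-- With j = suc p, the column "j-1" of M T j i is p, and i ≤ p, so that p ∸ i
-- interchanges bring it to position i.
M̃ : ∀ {n} → IndexedTree (suc n) → (j i : Fin (suc n)) → i < j → Matrix n n
M̃ T (suc p) i _ = moveColumnLeft p (toℕ p ∸ toℕ i) (M T (suc p) i)

UpperTriangularColumn : ∀ {n} → Matrix n n → Fin n → Set
UpperTriangularColumn Q k = ∀ x → k < x → Q x k ≡ 0ℤ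

{-# OPTIONS --safe #-}
-- Only the upper-triangularity of A matters, not the tree itself.  Deleting
-- column i moves the columns to its right one position left, while deleting
-- row j moves the rows below it one position up.  Hence in M the columns
-- outside the positions i, …, j-1 stay upper-triangular, and those inside may
-- have one extra entry just below the diagonal.  Each interchange moves one of
-- the latter to the right by one position, which makes it upper-triangular, and
-- shortens the interval of bad positions by one; in the end only i is left.
module Submission where

open import Defs
open import Data.Nat.Base as ℕ using (ℕ; zero; suc; z≤n; s≤s; s<s)
open import Data.Nat.Properties as ℕ
  using (≤-refl; <-trans; ≤-<-trans; <-≤-trans; n<1+n)
open import Data.Integer.Base using (0ℤ)
open import Data.Fin.Base using (Fin; zero; suc; toℕ; inject₁; punchIn; _<_; _≤_)
open import Data.Fin.Properties using (_≟_; <⇒≢; toℕ-injective; toℕ-inject₁; ≤̄⇒inject₁<)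
open import Data.Fin.Permutation.Components using (transpose)
open import Data.Product.Base using (proj₂)
open import Data.Sum.Base using (_⊎_; inj₁; inj₂)
open import Function.Base using (_∘_)
open import Relation.Binary.Definitions using (tri<; tri≈; tri>)
open import Relation.Binary.PropositionalEquality
  using (_≡_; _≢_; refl; sym; trans; cong; subst; ≢-sym)
open import Relation.Nullary using (yes; no; contradiction)
open import Relation.Nullary.Decidable using (dec-true; dec-false)

private
  variable
    m n : ℕ

transpose-first : (a b : Fin n) → transpose a b a ≡ b
transpose-first a b rewrite dec-true (a ≟ a) refl = refl

transpose-other : {a b k : Fin n} → k ≢ a → k ≢ b → transpose a b k ≡ k
transpose-other {a = a} {b} {k} k≢a k≢b
  rewrite dec-false (k ≟ a) k≢a | dec-false (k ≟ b) k≢b = refl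

k≤punchIn : (c : Fin (suc n)) (k : Fin n) → k ≤ punchIn c k
k≤punchIn zero    k       = ℕ.n≤1+n _
k≤punchIn (suc c) zero    = z≤n
k≤punchIn (suc c) (suc k) = s≤s (k≤punchIn c k)

punchIn≤suc : (c : Fin (suc n)) (k : Fin n) → punchIn c k ≤ suc k
punchIn≤suc zero    k       = ≤-refl
punchIn≤suc (suc c) zero    = z≤n
punchIn≤suc (suc c) (suc k) = s≤s (punchIn≤suc c k)

punchIn-below : (c : Fin (suc n)) (k : Fin n) → k < c → punchIn c k ≤ k
punchIn-below (suc c) zero    _         = z≤n
punchIn-below (suc c) (suc k) (s<s k<c) = s≤s (punchIn-below c k k<c)

punchIn-above : (c : Fin (suc n)) (k : Fin n) → c ≤ k → suc k ≤ punchIn c k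
punchIn-above zero    k       _         = ≤-refl
punchIn-above (suc c) (suc k) (s≤s c≤k) = s≤s (punchIn-above c k c≤k)

UpperTriangular : Matrix n n → Set
UpperTriangular Q = ∀ k → UpperTriangularColumn Q k

HessenbergColumn : Matrix n n → Fin n → Set
HessenbergColumn Q k = ∀ x → suc k < x → Q x k ≡ 0ℤ

record UpperTriangularOutside (a : ℕ) (p : Fin n) (Q : Matrix n n) : Set where
  field
    outside    : ∀ k → toℕ k ℕ.< a ⊎ p < k → UpperTriangularColumn Q k
    hessenberg : ∀ k → k ≢ p → HessenbergColumn Q k

open UpperTriangularOutside

forwardAdjacencyMatrix-upperTriangular :
  ∀ {N} (T : IndexedTree N) → UpperTriangular (forwardAdjacencyMatrix T)
forwardAdjacencyMatrix-upperTriangular T k x k<x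
  rewrite dec-false (x ≟ k) (≢-sym (<⇒≢ k<x))
        | dec-false (IndexedTree.forwardAdj? T (suc x) (suc k))
                    (λ adj → ℕ.<-asym (s<s k<x) (proj₂ adj))
        = refl

deleteRowColumn-outside :
  (i : Fin (suc n)) (p : Fin n) (Q : Matrix (suc n) (suc n)) →
  UpperTriangular Q →
  UpperTriangularOutside (toℕ i) p (deleteRowColumn (suc p) i Q)
deleteRowColumn-outside i p Q upper .outside k (inj₁ k<i) x k<x =
  upper _ _ (≤-<-trans (punchIn-below i k k<i)
                       (<-≤-trans k<x (k≤punchIn (suc p) x)))
deleteRowColumn-outside i p Q upper .outside k (inj₂ p<k) x k<x =
  upper _ _ (≤-<-trans (punchIn≤suc i k)
                       (<-≤-trans (s<s k<x)
                                  (punchIn-above (suc p) x (<-trans p<k k<x))))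
deleteRowColumn-outside i p Q upper .hessenberg k _ x 1+k<x =
  upper _ _ (≤-<-trans (punchIn≤suc i k)
                       (<-≤-trans 1+k<x (k≤punchIn (suc p) x)))

swapColumns-first : (a b : Fin n) (Q : Matrix m n) (x : Fin m) →
                    swapColumns a b Q x a ≡ Q x b
swapColumns-first a b Q x = cong (Q x) (transpose-first a b)

swapColumns-other : {a b k : Fin n} (Q : Matrix m n) (x : Fin m) →
                    k ≢ a → k ≢ b → swapColumns a b Q x k ≡ Q x k
swapColumns-other Q x k≢a k≢b = cong (Q x) (transpose-other k≢a k≢b)

swapColumns-outside :
  ∀ {a : ℕ} (q : Fin n) (Q : Matrix (suc n) (suc n)) → a ℕ.≤ toℕ q →
  UpperTriangularOutside a (suc q) Q →
  UpperTriangularOutside a (inject₁ q) (swapColumns (suc q) (inject₁ q) Q)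
swapColumns-outside {a = a} q Q a≤q inv = record
  { outside = out ; hessenberg = hess }
  where
  Q′ = swapColumns (suc q) (inject₁ q) Q

  column-suc-q : UpperTriangularColumn Q′ (suc q)
  column-suc-q x p<x =
    trans (swapColumns-first (suc q) (inject₁ q) Q x)
          (inv .hessenberg (inject₁ q) (<⇒≢ (≤̄⇒inject₁< ≤-refl)) x
            (subst (λ t → suc t ℕ.< toℕ x) (sym (toℕ-inject₁ q)) p<x))

  out : ∀ k → toℕ k ℕ.< a ⊎ inject₁ q < k → UpperTriangularColumn Q′ k
  out k (inj₁ k<a) x k<x =
    trans (swapColumns-other Q x (<⇒≢ (ℕ.m<n⇒m<1+n k<q))
                                 (<⇒≢ (subst (toℕ k ℕ.<_) (sym (toℕ-inject₁ q)) k<q)))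
          (inv .outside k (inj₁ k<a) x k<x)
    where
    k<q : toℕ k ℕ.< toℕ q
    k<q = <-≤-trans k<a a≤q
  out k (inj₂ q<k) with ℕ.m≤n⇒m<n∨m≡n (subst (ℕ._< toℕ k) (toℕ-inject₁ q) q<k)
  ... | inj₂ p≡k = subst (UpperTriangularColumn Q′) (toℕ-injective p≡k) column-suc-q
  ... | inj₁ p<k = λ x k<x →
    trans (swapColumns-other Q x (≢-sym (<⇒≢ p<k)) (≢-sym (<⇒≢ q<k)))
          (inv .outside k (inj₂ p<k) x k<x)

  hess : ∀ k → k ≢ inject₁ q → HessenbergColumn Q′ k
  hess k k≢q x 1+k<x with toℕ k ℕ.≟ toℕ (suc q)
  ... | yes k≡p = subst (UpperTriangularColumn Q′) (sym (toℕ-injective k≡p)) column-suc-q x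
                        (<-trans (n<1+n _) 1+k<x)
  ... | no k≢p =
    trans (swapColumns-other Q x k≢1+q k≢q) (inv .hessenberg k k≢1+q x 1+k<x)
    where
    k≢1+q : k ≢ suc q
    k≢1+q = k≢p ∘ cong toℕ

moveColumnLeft-upperTriangular :
  ∀ {a} (s : ℕ) (p : Fin n) (Q : Matrix n n) → toℕ p ≡ s ℕ.+ a →
  UpperTriangularOutside a p Q →
  ∀ k → toℕ k ≢ a → UpperTriangularColumn (moveColumnLeft p s Q) k
moveColumnLeft-upperTriangular zero p Q refl inv k k≢a with ℕ.<-cmp (toℕ k) (toℕ p)
... | tri< k<p _ _ = inv .outside k (inj₁ k<p)
... | tri≈ _ k≡p _ = contradiction k≡p k≢a
... | tri> _ _ p<k = inv .outside k (inj₂ p<k)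
moveColumnLeft-upperTriangular {a = a} (suc s) (suc q) Q eq inv =
  moveColumnLeft-upperTriangular s (inject₁ q) _
    (trans (toℕ-inject₁ q) q≡s+a)
    (swapColumns-outside q Q (subst (a ℕ.≤_) (sym q≡s+a) (ℕ.m≤n+m a s)) inv)
  where
  q≡s+a : toℕ q ≡ s ℕ.+ a
  q≡s+a = ℕ.suc-injective eq

corollary10p1 : ∀ {n : ℕ} (T : IndexedTree (suc n)) (i j : Fin (suc n)) (i<j : i < j) (k : Fin n) →
    toℕ k ≢ toℕ i → UpperTriangularColumn (M̃ T j i i<j) k
corollary10p1 T i (suc p) (s≤s i≤p) =
  moveColumnLeft-upperTriangular (toℕ p ℕ.∸ toℕ i) p (M T (suc p) i)
    (sym (ℕ.m∸n+n≡m i≤p))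
    (deleteRowColumn-outside i p (forwardAdjacencyMatrix T)
      (forwardAdjacencyMatrix-upperTriangular T))
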